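{- If $G$ is a randomly $3$-dimensional graph, then $G$ is $3$-regular.
   Context: All graphs are finite, simple and connected. For an ordered set $W=\{w_1,\dots,w_k\}\subseteq V(G)$ and $v\in V(G)$, $r(v|W)=(d(v,w_1),\dots,d(v,w_k))$, where $d$ denotes graph distance. $W$ is a resolving set if distinct vertices have distinct representations with respect to $W$; a basis is a minimum-size resolving set and its size is the metric dimension $\beta(G)$. $G$ is randomly $k$-dimensional if $\beta(G)=k$ and every $k$-subset of $V(G)$ is a basis of $G$. -}

module Defs where

open import Data.Nat using (ℕ; zero; suc; _≤_; _<_)
open import Data.Fin using (Fin)
open import Data.Fin.Subset using (Subset; _∈_; ∣_∣)
open import Data.Vec using (tabulate)
open import Data.Bool using (Bool; true; false)
open import Data.Product using (Σ; _×_; ∃)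
open import Relation.Nullary using (¬_; Dec; does)
open import Relation.Binary.PropositionalEquality using (_≡_)

record Graph (n : ℕ) : Set₁ where
  field
    Adj    : Fin n → Fin n → Set
    adj?   : ∀ u v → Dec (Adj u v)
    sym    : ∀ {u v} → Adj u v → Adj v u
    irrefl : ∀ {u} → ¬ Adj u u
open Graph public

module _ {n : ℕ} (G : Graph n) where

  data Walk : Fin n → Fin n → ℕ → Set where
    here : ∀ {u} → Walk u u zero
    step : ∀ {u v w k} → Adj G u v → Walk v w k → Walk u w (suc k)

  Connected : Set
  Connected = ∀ u v → ∃ λ k → Walk u v k

  Dist : Fin n → Fin n → ℕ → Set
  Dist u v k = Walk u v k × (∀ m → Walk u v m → k ≤ m)

  Resolving : Subset n → Set
  Resolving W = ∀ u v →
    (∀ w → w ∈ W → ∀ k → (Dist u w k → Dist v w k) × (Dist v w k → Dist u w k)) →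
    u ≡ v

  MetricDim : ℕ → Set
  MetricDim k = (Σ (Subset n) λ W → Resolving W × ∣ W ∣ ≡ k)
              × (∀ W → Resolving W → k ≤ ∣ W ∣)

  RandomlyDim : ℕ → Set
  RandomlyDim k = MetricDim k × (∀ W → ∣ W ∣ ≡ k → Resolving W)

  nbhd : Fin n → Subset n
  nbhd u = tabulate λ v → does (adj? G u v)

  degree : Fin n → ℕ
  degree u = ∣ nbhd u ∣

  Regular : ℕ → Set
  Regular r = ∀ u → degree u ≡ r

{-# OPTIONS --safe #-}
module Submission where

-- For distinct x, y at most two vertices v satisfy d(x,v) = d(y,v), while any two vertices
-- u, v leave some pair x ≠ y unresolved. Counting quadruples makes both bounds tight, so
-- exactly two vertices fail to resolve x, y, and the spheres around a vertex w satisfy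
-- ∑ kᵢ² = 3n - 2. For a vertex v ≠ w the k neighbours of w split into p, q, r according to
-- whether they are closer to v than w, equally far, or farther; tightness evaluates
-- ∑ᵥ (p² + q² + r²) and ∑ᵥ q. Together with ∑ kᵢ² = 3n - 2 this excludes k ≥ 5 and leaves
-- n = 7 for k = 4; there the two vertices outside the closed neighbourhood must lie in
-- different spheres, so the farther one has degree 1, and a pendant vertex is resolved from
-- its neighbour by every vertex. A vertex of degree 3 forces n ≤ 10, and then the sphere equation cannot
-- hold at vertices of degrees 2 and 3 simultaneously. Finally, not all degrees are 2: the
-- total of p equals the total of r by symmetry, but ∑ᵥ p exceeds ∑ᵥ r at a vertex of degree 2.

open import Defs
open import Algebra.Properties.Semiring.Sum as Sums using ()
open import Data.Bool using (Bool; true; false; if_then_else_)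
open import Data.Empty using (⊥; ⊥-elim)
open import Data.Fin using (Fin; zero; suc; toℕ; fromℕ<)
open import Data.Fin.Properties using (_≟_; any?; toℕ-fromℕ<; fromℕ<-toℕ)
open import Data.Fin.Subset using (Subset; _∈_; ∣_∣; _∪_; ⁅_⁆; _⊆_; inside; outside)
import Data.Fin.Subset.Properties as Subset
import Data.Nat as ℕ
open import Data.List using (List; []; _∷_; map; concatMap; upTo)
import Data.List.Membership.Propositional as List
open import Data.List.Membership.DecPropositional ℕ._≟_ using (_∈?_)
open import Data.List.Membership.Propositional.Properties using (∈-map⁺; ∈-upTo⁺; ∈-concat⁺′)
open import Data.List.Relation.Unary.Any using (here)
open import Data.Nat using (ℕ; zero; suc; _+_; _*_; _∸_; _≤_; _<_; z≤n; s≤s; s≤s⁻¹)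
open import Data.Nat.Properties hiding (_≟_)
open import Data.Nat.Solver using (module +-*-Solver)
open import Data.Nat.Tactic.RingSolver using (solve-∀)
open import Data.Product using (∃; _×_; _,_; proj₁; proj₂)
open import Data.Sum using (_⊎_; inj₁; inj₂; [_,_]′)
open import Data.Vec using (tabulate; []; _∷_; here; there)
open import Data.Vec.Properties using (lookup∘tabulate; []=⇒lookup)
open import Function using (_∘_; id)
open import Relation.Nullary using (¬_; Dec; yes; no; does; contradiction; ¬?)
open import Relation.Nullary.Decidable using (map′; _×-dec_; dec-true; dec-false; decidable-stable; from-no)
open import Relation.Binary.PropositionalEquality using (_≡_; _≢_; refl; trans; cong; cong₂; subst; module ≡-Reasoning)
import Relation.Binary.PropositionalEquality as ≡

open +-*-Solver using (solve; con; _:+_; _:*_; _:=_)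
open Sums +-*-semiring using (sum; sum-cong-≗; ∑-distrib-+; ∑-comm; *-distribˡ-sum; *-distribʳ-sum)

private
  variable
    n : ℕ
    P Q : Set

-- Indicators, finite sums and double sums.

⟦_⟧ : Dec P → ℕ
⟦ p ⟧ = if does p then 1 else 0

⟦⟧-true : (p? : Dec P) → P → ⟦ p? ⟧ ≡ 1
⟦⟧-true p? p = cong (if_then 1 else 0) (dec-true p? p)

⟦⟧-false : (p? : Dec P) → ¬ P → ⟦ p? ⟧ ≡ 0
⟦⟧-false p? ¬p = cong (if_then 1 else 0) (dec-false p? ¬p)

⟦⟧-cong : (p? : Dec P) (q? : Dec Q) → (P → Q) → (Q → P) → ⟦ p? ⟧ ≡ ⟦ q? ⟧
⟦⟧-cong (yes p) q? f g = ≡.sym (⟦⟧-true q? (f p))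
⟦⟧-cong (no ¬p) q? f g = ≡.sym (⟦⟧-false q? (¬p ∘ g))

⟦⟧-idem : (p? : Dec P) → ⟦ p? ⟧ * ⟦ p? ⟧ ≡ ⟦ p? ⟧
⟦⟧-idem (yes _) = refl
⟦⟧-idem (no _)  = refl

sum₂ : (Fin n → Fin n → ℕ) → ℕ
sum₂ f = sum λ x → sum λ y → f x y

sum-const : ∀ n c → sum {n} (λ _ → c) ≡ n * c
sum-const zero    c = refl
sum-const (suc n) c = cong (c +_) (sum-const n c)

sum-mono : {f g : Fin n → ℕ} → (∀ i → f i ≤ g i) → sum f ≤ sum g
sum-mono {zero}  f≤g = z≤n
sum-mono {suc n} f≤g = +-mono-≤ (f≤g zero) (sum-mono (f≤g ∘ suc))

-- A strict gap at one index would survive in the totals. This turns the double count below into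
-- exact values.
sum-tight : {f g : Fin n → ℕ} → (∀ i → f i ≤ g i) → sum g ≤ sum f → ∀ i → f i ≡ g i
sum-tight {suc n} {f} {g} f≤g Σg≤Σf zero =
  ≤-antisym (f≤g zero)
    (+-cancelʳ-≤ _ _ _ (≤-trans Σg≤Σf (+-monoʳ-≤ (f zero) (sum-mono (f≤g ∘ suc)))))
sum-tight {suc n} {f} {g} f≤g Σg≤Σf (suc i) =
  sum-tight (f≤g ∘ suc)
    (+-cancelˡ-≤ (g zero) _ _ (≤-trans Σg≤Σf (+-monoˡ-≤ _ (f≤g zero)))) i

term≤sum : (f : Fin n → ℕ) → ∀ i → f i ≤ sum f
term≤sum f zero    = m≤m+n _ _
term≤sum f (suc i) = ≤-trans (term≤sum (f ∘ suc) i) (m≤n+m _ _)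

two-terms≤sum : (f : Fin n → ℕ) → ∀ {i j} → i ≢ j → f i + f j ≤ sum f
two-terms≤sum f {zero}  {zero}  i≢j = contradiction refl i≢j
two-terms≤sum f {zero}  {suc j} i≢j = +-monoʳ-≤ (f zero) (term≤sum (f ∘ suc) j)
two-terms≤sum f {suc i} {zero}  i≢j =
  ≤-trans (≤-reflexive (+-comm (f (suc i)) _)) (+-monoʳ-≤ (f zero) (term≤sum (f ∘ suc) i))
two-terms≤sum f {suc i} {suc j} i≢j =
  ≤-trans (two-terms≤sum (f ∘ suc) (i≢j ∘ cong suc)) (m≤n+m _ _)

sum-zero : {f : Fin n → ℕ} → (∀ i → f i ≡ 0) → sum f ≡ 0
sum-zero {n} f≡0 = trans (sum-cong-≗ f≡0) (trans (sum-const n 0) (*-zeroʳ n))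

sum-*ˡ : ∀ c (f : Fin n → ℕ) → sum (λ v → c * f v) ≡ c * sum f
sum-*ˡ c f = ≡.sym (*-distribˡ-sum c f)

δ : Fin n → Fin n → ℕ
δ x y = ⟦ x ≟ y ⟧

sum-δ* : (j : Fin n) (f : Fin n → ℕ) → sum (λ i → δ j i * f i) ≡ f j
sum-δ* {suc n} zero f =
  trans (cong₂ _+_ (*-identityˡ (f zero)) (sum-zero {f = λ i → δ zero (suc i) * f (suc i)} λ i → refl)) (+-identityʳ _)
sum-δ* {suc n} (suc j) f =
  trans (sum-cong-≗ λ i → cong (_* f (suc i)) (⟦⟧-cong (suc j ≟ suc i) (j ≟ i) (λ { refl → refl }) (cong suc)))
        (sum-δ* j (f ∘ suc))

sum-δ : (j : Fin n) → sum (δ j) ≡ 1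
sum-δ j = trans (sum-cong-≗ λ i → ≡.sym (*-identityʳ (δ j i))) (sum-δ* j (λ _ → 1))

sum*sum : ∀ {m} (f : Fin n → ℕ) (g : Fin m → ℕ) → sum f * sum g ≡ sum λ x → sum λ y → f x * g y
sum*sum f g = trans (*-distribʳ-sum (sum g) f) (sum-cong-≗ λ x → *-distribˡ-sum (f x) g)

sum₂-+ : (f g : Fin n → Fin n → ℕ) → sum₂ (λ x y → f x y + g x y) ≡ sum₂ f + sum₂ g
sum₂-+ f g = trans (sum-cong-≗ λ x → ∑-distrib-+ (f x) (g x)) (∑-distrib-+ (sum ∘ f) (sum ∘ g))

sum₂-cong : {f g : Fin n → Fin n → ℕ} → (∀ x y → f x y ≡ g x y) → sum₂ f ≡ sum₂ g
sum₂-cong f≡g = sum-cong-≗ λ x → sum-cong-≗ (f≡g x)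

sum₂-mono : {f g : Fin n → Fin n → ℕ} → (∀ x y → f x y ≤ g x y) → sum₂ f ≤ sum₂ g
sum₂-mono f≤g = sum-mono λ x → sum-mono (f≤g x)

sum₂-*ˡ : ∀ c (f : Fin n → Fin n → ℕ) → sum₂ (λ x y → c * f x y) ≡ c * sum₂ f
sum₂-*ˡ c f = ≡.sym (trans (*-distribˡ-sum c (sum ∘ f)) (sum-cong-≗ λ x → *-distribˡ-sum c (f x)))

sum₂-sum : ∀ {m} (f : Fin n → Fin n → Fin m → ℕ) → sum₂ (λ x y → sum (f x y)) ≡ sum λ v → sum₂ λ x y → f x y v
sum₂-sum f = trans (sum-cong-≗ λ x → ∑-comm (f x)) (∑-comm λ x v → sum λ y → f x y v)

sum₂-comm : (f : Fin n → Fin n → Fin n → Fin n → ℕ) →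
  sum₂ (λ u v → sum₂ (f u v)) ≡ sum₂ λ x y → sum₂ λ u v → f u v x y
sum₂-comm f = trans (sum₂-sum λ u v x → sum (f u v x)) (sum-cong-≗ λ x → sum₂-sum λ u v → f u v x)

sum₂-tight : {f g : Fin n → Fin n → ℕ} → (∀ x y → f x y ≤ g x y) → sum₂ g ≤ sum₂ f → ∀ x y → f x y ≡ g x y
sum₂-tight f≤g Σg≤Σf x =
  sum-tight (f≤g x) (≤-reflexive (≡.sym (sum-tight (λ x → sum-mono (f≤g x)) Σg≤Σf x)))

sum₂-δ* : (f : Fin n → Fin n → ℕ) → sum₂ (λ x y → δ x y * f x y) ≡ sum λ x → f x x
sum₂-δ* f = sum-cong-≗ λ x → sum-δ* x (f x)

δᶜ : Fin n → Fin n → ℕ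
δᶜ x y = ⟦ ¬? (x ≟ y) ⟧

δ+δᶜ≡1 : (x y : Fin n) → δ x y + δᶜ x y ≡ 1
δ+δᶜ≡1 x y with x ≟ y
... | yes _ = refl
... | no _  = refl

δᶜ≡1 : {x y : Fin n} → x ≢ y → δᶜ x y ≡ 1
δᶜ≡1 {x = x} {y} = ⟦⟧-true (¬? (x ≟ y))

sum₂-split : (f : Fin n → Fin n → ℕ) → sum₂ f ≡ sum (λ x → f x x) + sum₂ (λ x y → δᶜ x y * f x y)
sum₂-split f = begin
  sum₂ f                                                     ≡⟨ sum₂-cong (λ x y → ≡.sym (trans (cong (_* f x y) (δ+δᶜ≡1 x y)) (*-identityˡ _))) ⟩
  sum₂ (λ x y → (δ x y + δᶜ x y) * f x y)                    ≡⟨ sum₂-cong (λ x y → *-distribʳ-+ (f x y) (δ x y) (δᶜ x y)) ⟩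
  sum₂ (λ x y → δ x y * f x y + δᶜ x y * f x y)              ≡⟨ sum₂-+ (λ x y → δ x y * f x y) (λ x y → δᶜ x y * f x y) ⟩
  sum₂ (λ x y → δ x y * f x y) + sum₂ (λ x y → δᶜ x y * f x y) ≡⟨ cong (_+ sum₂ (λ x y → δᶜ x y * f x y)) (sum₂-δ* f) ⟩
  sum (λ x → f x x) + sum₂ (λ x y → δᶜ x y * f x y)          ∎
  where open ≡-Reasoning

-- Subset sizes and least witnesses.

∣tabulate∣ : (f : Fin n → Bool) → ∣ tabulate f ∣ ≡ sum λ i → if f i then 1 else 0
∣tabulate∣ {zero}  f = refl
∣tabulate∣ {suc n} f with f zero
... | true  = cong suc (∣tabulate∣ (f ∘ suc))
... | false = ∣tabulate∣ (f ∘ suc)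

∈-tabulate⁻ : {R : Fin n → Set} (R? : ∀ i → Dec (R i)) {i : Fin n} → i ∈ tabulate (does ∘ R?) → R i
∈-tabulate⁻ R? {i} i∈ with R? i | trans (≡.sym (lookup∘tabulate (does ∘ R?) i)) ([]=⇒lookup i∈)
... | yes r | _ = r
... | no _  | ()

subset-of-size : ∀ k (p : Subset n) → k ≤ ∣ p ∣ → ∃ λ q → q ⊆ p × ∣ q ∣ ≡ k
subset-of-size zero [] _ = [] , (λ ()) , refl
subset-of-size k (outside ∷ p) k≤ with subset-of-size k p k≤
... | q , q⊆p , eq = outside ∷ q , (λ { (there x) → there (q⊆p x) }) , eq
subset-of-size zero (inside ∷ p) _ with subset-of-size zero p z≤n
... | q , q⊆p , eq = outside ∷ q , (λ { (there x) → there (q⊆p x) }) , eq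
subset-of-size (suc k) (inside ∷ p) (s≤s k≤) with subset-of-size k p k≤
... | q , q⊆p , eq = inside ∷ q , (λ { here → here ; (there x) → there (q⊆p x) }) , cong suc eq

∣p∪q∣≤∣p∣+∣q∣ : (p q : Subset n) → ∣ p ∪ q ∣ ≤ ∣ p ∣ + ∣ q ∣
∣p∪q∣≤∣p∣+∣q∣ [] [] = z≤n
∣p∪q∣≤∣p∣+∣q∣ (outside ∷ p) (outside ∷ q) = ∣p∪q∣≤∣p∣+∣q∣ p q
∣p∪q∣≤∣p∣+∣q∣ (outside ∷ p) (inside  ∷ q) =
  ≤-trans (s≤s (∣p∪q∣≤∣p∣+∣q∣ p q)) (≤-reflexive (≡.sym (+-suc ∣ p ∣ ∣ q ∣)))
∣p∪q∣≤∣p∣+∣q∣ (inside  ∷ p) (outside ∷ q) = s≤s (∣p∪q∣≤∣p∣+∣q∣ p q)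
∣p∪q∣≤∣p∣+∣q∣ (inside  ∷ p) (inside  ∷ q) =
  s≤s (≤-trans (∣p∪q∣≤∣p∣+∣q∣ p q) (+-monoʳ-≤ ∣ p ∣ (n≤1+n ∣ q ∣)))

least : {R : ℕ → Set} → (∀ k → Dec (R k)) → ∀ k → R k → ∃ λ m → R m × (∀ j → R j → m ≤ j)
least R? zero r = zero , r , λ _ _ → z≤n
least R? (suc k) r with R? zero
... | yes r₀ = zero , r₀ , λ _ _ → z≤n
... | no ¬r₀ with least (R? ∘ suc) k r
...   | m , rm , m-min = suc m , rm , λ { zero r₀ → contradiction r₀ ¬r₀ ; (suc j) rj → s≤s (m-min j rj) }

-- Elementary inequalities.

-- The slack `o` is explicit, so that refuting an inequality reduces to a polynomial identity
-- without subtraction.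
m≤n∧m≡1+n+o⇒⊥ : ∀ {m n} o → m ≤ n → m ≡ suc (n + o) → ⊥
m≤n∧m≡1+n+o⇒⊥ {n = n} o m≤n refl = <⇒≱ (s≤s (m≤m+n n o)) m≤n

2ab≤a²+b² : ∀ a b → 2 * (a * b) ≤ a * a + b * b
2ab≤a²+b² a b with ≤-total a b
... | inj₁ a≤b = subst (λ b → 2 * (a * b) ≤ a * a + b * b) (m+[n∸m]≡n a≤b)
  (≤-trans (m≤m+n _ ((b ∸ a) * (b ∸ a))) (≤-reflexive (expand a (b ∸ a))))
  where
  expand : ∀ a c → 2 * (a * (a + c)) + c * c ≡ a * a + (a + c) * (a + c)
  expand = solve-∀
... | inj₂ b≤a = subst (λ a → 2 * (a * b) ≤ a * a + b * b) (m+[n∸m]≡n b≤a)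
  (≤-trans (m≤m+n _ ((a ∸ b) * (a ∸ b))) (≤-reflexive (expand b (a ∸ b))))
  where
  expand : ∀ b c → 2 * ((b + c) * b) + c * c ≡ (b + c) * (b + c) + b * b
  expand = solve-∀

sumSq : ℕ → ℕ → ℕ → ℕ
sumSq p q r = p * p + q * q + r * r

[p+q+r]²≤3sumSq : ∀ p q r → (p + q + r) * (p + q + r) ≤ 3 * sumSq p q r
[p+q+r]²≤3sumSq p q r = begin
  (p + q + r) * (p + q + r)                                      ≡⟨ expand p q r ⟩
  sumSq p q r + (2 * (p * q) + 2 * (q * r) + 2 * (p * r))        ≤⟨ +-monoʳ-≤ (sumSq p q r) (+-mono-≤ (+-mono-≤ (2ab≤a²+b² p q) (2ab≤a²+b² q r)) (2ab≤a²+b² p r)) ⟩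
  sumSq p q r + ((p * p + q * q) + (q * q + r * r) + (p * p + r * r)) ≡⟨ collect (p * p) (q * q) (r * r) ⟩
  3 * sumSq p q r                                                ∎
  where
  open ≤-Reasoning
  expand : ∀ p q r → (p + q + r) * (p + q + r) ≡ p * p + q * q + r * r + (2 * (p * q) + 2 * (q * r) + 2 * (p * r))
  expand = solve-∀
  collect : ∀ x y z → x + y + z + ((x + y) + (y + z) + (x + z)) ≡ 3 * (x + y + z)
  collect = solve-∀

-- The term `2 * q` lifts the balanced split (1,1,1), whose squares sum only to 3, to the value 5 of
-- (1,0,2) and (2,0,1). Its total over all vertices is known exactly from `sum-q`.
5≤2q+sumSq : ∀ p q r → p + q + r ≡ 3 → 1 ≤ p → 5 ≤ 2 * q + sumSq p q r
5≤2q+sumSq 1 0 _ refl _ = ≤-refl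
5≤2q+sumSq 1 1 _ refl _ = ≤-refl
5≤2q+sumSq 1 2 _ refl _ = m≤m+n 5 4
5≤2q+sumSq 1 (suc (suc (suc _))) _ () _
5≤2q+sumSq 2 0 _ refl _ = ≤-refl
5≤2q+sumSq 2 1 _ refl _ = m≤m+n 5 2
5≤2q+sumSq 2 (suc (suc _)) _ () _
5≤2q+sumSq 3 0 _ refl _ = m≤m+n 5 4
5≤2q+sumSq 3 (suc _) _ () _
5≤2q+sumSq (suc (suc (suc (suc _)))) _ _ () _

-- Distances from adjacent vertices to a common vertex.

data Near (s t : ℕ) : Set where
  lower  : suc s ≡ t → Near s t
  level  : s ≡ t → Near s t
  higher : s ≡ suc t → Near s t

near : ∀ {s t} → s ≤ suc t → t ≤ suc s → Near s t
near {zero}  {zero}        _ _ = level refl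
near {zero}  {suc zero}    _ _ = lower refl
near {zero}  {suc (suc _)} _ (s≤s ())
near {suc zero}    {zero}  _ _ = higher refl
near {suc (suc _)} {zero}  (s≤s ()) _
near {suc s} {suc t} (s≤s p) (s≤s q) with near p q
... | lower  eq = lower (cong suc eq)
... | level  eq = level (cong suc eq)
... | higher eq = higher (cong suc eq)

-- The reference distance `t` comes first and the neighbour's distance `s` second, so `lo t`, `eq t`
-- and `hi t` are the indicators of three classes of neighbours.
lo eq hi : ℕ → ℕ → ℕ
lo t s = ⟦ suc s ℕ.≟ t ⟧
eq t s = ⟦ s ℕ.≟ t ⟧
hi t s = ⟦ s ℕ.≟ suc t ⟧

lo+eq+hi≡1 : ∀ {s t} → Near s t → lo t s + eq t s + hi t s ≡ 1
lo+eq+hi≡1 {s} (lower refl)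
  rewrite ⟦⟧-true (suc s ℕ.≟ suc s) refl | ⟦⟧-false (s ℕ.≟ suc s) (λ ()) | ⟦⟧-false (s ℕ.≟ suc (suc s)) (λ ()) = refl
lo+eq+hi≡1 {s} (level refl)
  rewrite ⟦⟧-false (suc s ℕ.≟ s) (λ ()) | ⟦⟧-true (s ℕ.≟ s) refl | ⟦⟧-false (s ℕ.≟ suc s) (λ ()) = refl
lo+eq+hi≡1 {_} {t} (higher refl)
  rewrite ⟦⟧-false (suc (suc t) ℕ.≟ t) (λ ()) | ⟦⟧-false (suc t ℕ.≟ t) (λ ()) | ⟦⟧-true (suc t ℕ.≟ suc t) refl = refl

-- Since `s` lies in exactly one of the three classes around `t`, it equals `s′` exactly when `s′`
-- lies in the same class. The product form is what makes squares of class sizes appear after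
-- summation.
⟦≟⟧-near : ∀ {s t} → Near s t → ∀ s′ →
  ⟦ s ℕ.≟ s′ ⟧ ≡ lo t s * lo t s′ + eq t s * eq t s′ + hi t s * hi t s′
⟦≟⟧-near {s} (lower refl) s′
  rewrite ⟦⟧-true (suc s ℕ.≟ suc s) refl | ⟦⟧-false (s ℕ.≟ suc s) (λ ()) | ⟦⟧-false (s ℕ.≟ suc (suc s)) (λ ())
  = trans (⟦⟧-cong (s ℕ.≟ s′) (suc s′ ℕ.≟ suc s) (λ e → cong suc (≡.sym e)) (λ e → ≡.sym (suc-injective e)))
          (pad (lo (suc s) s′))
  where
  pad : ∀ x → x ≡ x + 0 + 0 + 0
  pad = solve-∀
⟦≟⟧-near {s} (level refl) s′
  rewrite ⟦⟧-false (suc s ℕ.≟ s) (λ ()) | ⟦⟧-true (s ℕ.≟ s) refl | ⟦⟧-false (s ℕ.≟ suc s) (λ ())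
  = trans (⟦⟧-cong (s ℕ.≟ s′) (s′ ℕ.≟ s) ≡.sym ≡.sym) (pad (eq s s′))
  where
  pad : ∀ x → x ≡ x + 0 + 0
  pad = solve-∀
⟦≟⟧-near {_} {t} (higher refl) s′
  rewrite ⟦⟧-false (suc (suc t) ℕ.≟ t) (λ ()) | ⟦⟧-false (suc t ℕ.≟ t) (λ ()) | ⟦⟧-true (suc t ℕ.≟ suc t) refl
  = trans (⟦⟧-cong (suc t ℕ.≟ s′) (s′ ℕ.≟ suc t) ≡.sym ≡.sym) (pad (hi t s′))
  where
  pad : ∀ x → x ≡ x + 0
  pad = solve-∀

-- Sums over layers, and sums of squares of compositions.

sum-toℕ : ∀ {L s} → s < L → (g : ℕ → ℕ) → sum {L} (λ i → ⟦ s ℕ.≟ toℕ i ⟧ * g (toℕ i)) ≡ g s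
sum-toℕ {L} {s} s<L g = begin
  sum {L} (λ i → ⟦ s ℕ.≟ toℕ i ⟧ * g (toℕ i))        ≡⟨ sum-cong-≗ {L} (λ i → cong (_* g (toℕ i)) (⟦⟧-cong (s ℕ.≟ toℕ i) (fromℕ< s<L ≟ i)
                                                        (λ { refl → fromℕ<-toℕ i s<L }) (λ { refl → ≡.sym (toℕ-fromℕ< s<L) }))) ⟩
  sum {L} (λ i → δ (fromℕ< s<L) i * g (toℕ i))       ≡⟨ sum-δ* (fromℕ< s<L) (g ∘ toℕ) ⟩
  g (toℕ (fromℕ< s<L))                               ≡⟨ cong g (toℕ-fromℕ< s<L) ⟩
  g s                                                ∎
  where open ≡-Reasoning

-- The sums of squares of the compositions of m into at most b parts.
squareSums : ℕ → ℕ → List ℕ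
squareSums _       zero    = 0 ∷ []
squareSums zero    (suc _) = []
squareSums (suc b) (suc m) = concatMap (λ j → map (suc j * suc j +_) (squareSums b (m ∸ j))) (upTo (suc m))

-- Zero entries are skipped for free and each positive entry uses one unit of `b`; there are at most
-- `sum f` positive entries. Whatever the length `L`, the sum of squares thus lies in a finite list
-- that can be evaluated.
∈-squareSums : ∀ {L} (f : Fin L → ℕ) b → sum f ≤ b → sum (λ i → f i * f i) List.∈ squareSums b (sum f)
∈-squareSums {zero} f b _ = here refl
∈-squareSums {suc L} f b Σf≤b with f zero
... | zero  = ∈-squareSums (f ∘ suc) b Σf≤b
∈-squareSums {suc L} f (suc b) (s≤s Σf≤b) | suc j =
  ∈-concat⁺′ (∈-map⁺ (suc j * suc j +_) (subst (λ m → sum (λ i → f (suc i) * f (suc i)) List.∈ squareSums b m) (≡.sym (m+n∸m≡n j _))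
                 (∈-squareSums (f ∘ suc) b (≤-trans (m≤n+m _ j) Σf≤b))))
             (∈-map⁺ _ (∈-upTo⁺ (s≤s (m≤m+n j _))))

≤-square : ∀ m → m ≤ m * m
≤-square zero    = z≤n
≤-square (suc m) = m≤m+n (suc m) _

-- Below n, k, m, M and S stand for the order, the degree of a vertex w, the sums of the
-- sizes and of the squared sizes of its layers from 2 on, and ∑ᵥ (p² + q² + r²).

-- Eliminating `S` and dividing by `k` gives nk + 6 ≤ 4k + 3n, while the sphere equation with m ≤ M
-- gives k² + m + 3 ≤ 3n. With n = 1 + k + m the two add up to a contradiction; writing k as 5 + j
-- makes the excess a polynomial with nonnegative coefficients.
degree≥5-arith : ∀ {n m M S} j → let k = 5 + j in
  1 + (k + m) ≡ n → 1 + (k * k + M) + 2 ≡ 3 * n → m ≤ M →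
  S + 2 * k ≡ 2 * (k * k) + n * k → n * (k * k) + 3 * (k * k) ≤ 3 * S + k * k → ⊥
degree≥5-arith {m = m} {M} {S} j refl M-eq m≤M S-eq bound =
  m≤n∧m≡1+n+o⇒⊥ (7 + 11 * j + 2 * (j * j) + m * j) (+-mono-≤ first second) (gap j m)
  where
  k = 5 + j
  N = 1 + (k + m)
  lhs : ∀ n k → k * (n * k + 6) + 3 * (k * k) ≡ n * (k * k) + 3 * (k * k) + 6 * k
  lhs = solve-∀
  mid : ∀ S k → 3 * S + k * k + 6 * k ≡ 3 * (S + 2 * k) + k * k
  mid = solve-∀
  rhs : ∀ n k → 3 * (2 * (k * k) + n * k) + k * k ≡ k * (4 * k + 3 * n) + 3 * (k * k)
  rhs = solve-∀
  first : N * k + 6 ≤ 4 * k + 3 * N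
  first = *-cancelˡ-≤ k (+-cancelʳ-≤ (3 * (k * k)) _ _ (begin
    k * (N * k + 6) + 3 * (k * k)             ≡⟨ lhs N k ⟩
    N * (k * k) + 3 * (k * k) + 6 * k         ≤⟨ +-monoˡ-≤ (6 * k) bound ⟩
    3 * S + k * k + 6 * k                     ≡⟨ mid S k ⟩
    3 * (S + 2 * k) + k * k                   ≡⟨ cong (λ s → 3 * s + k * k) S-eq ⟩
    3 * (2 * (k * k) + N * k) + k * k         ≡⟨ rhs N k ⟩
    k * (4 * k + 3 * N) + 3 * (k * k)         ∎))
    where open ≤-Reasoning
  second : 1 + (k * k + m) + 2 ≤ 3 * N
  second = ≤-trans (+-monoˡ-≤ 2 (s≤s (+-monoʳ-≤ (k * k) m≤M))) (≤-reflexive M-eq)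
  gap : ∀ j m → let k = 5 + j ; n = 1 + (k + m) in
    n * k + 6 + (1 + (k * k + m) + 2) ≡ suc (4 * k + 3 * n + 3 * n + (7 + 11 * j + 2 * (j * j) + m * j))
  gap = solve 2 (λ j m → let k = con 5 :+ j ; n = con 1 :+ (k :+ m) in
    n :* k :+ con 6 :+ (con 1 :+ (k :* k :+ m) :+ con 2) :=
    con 1 :+ (con 4 :* k :+ con 3 :* n :+ con 3 :* n :+ (con 7 :+ con 11 :* j :+ con 2 :* (j :* j) :+ m :* j))) refl

-- Eliminating `S` leaves n ≤ 7, that is m ≤ 2. The sphere equation reads M + 19 = 3n, which has no
-- solution at n = 5 or 6 and gives M = 2 at n = 7.
degree4-arith : ∀ {n m M S} →
  1 + (4 + m) ≡ n → 1 + (16 + M) + 2 ≡ 3 * n → m ≤ M →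
  S + 8 ≡ 32 + n * 4 → n * 6 + 16 ≤ S + 6 → m ≡ 2 × M ≡ 2
degree4-arith {m = 0} {M} refl M-eq _ _ _ = ⊥-elim (m≤n∧m≡1+n+o⇒⊥ (3 + M) (≤-reflexive M-eq) (gap M))
  where
  gap : ∀ M → 1 + (16 + M) + 2 ≡ suc (15 + (3 + M))
  gap M = +-comm (17 + M) 2
degree4-arith {m = 1} {M} refl M-eq _ _ _ = ⊥-elim (m≤n∧m≡1+n+o⇒⊥ M (≤-reflexive M-eq) (gap M))
  where
  gap : ∀ M → 1 + (16 + M) + 2 ≡ suc (18 + M)
  gap M = +-comm (17 + M) 2
degree4-arith {m = 2} {M} refl M-eq _ _ _ = refl , +-cancelˡ-≡ 17 _ _ (+-cancelʳ-≡ 2 _ _ M-eq)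
degree4-arith {m = suc (suc (suc i))} {M} {S} refl _ _ S-eq bound = ⊥-elim
  (m≤n∧m≡1+n+o⇒⊥ (1 + 2 * i)
    (≤-trans (+-monoˡ-≤ 8 bound) (≤-reflexive (trans (shift S) (cong (_+ 6) S-eq)))) (gap i))
  where
  shift : ∀ S → S + 6 + 8 ≡ S + 8 + 6
  shift = solve-∀
  gap : ∀ i → (8 + i) * 6 + 16 + 8 ≡ suc (32 + (8 + i) * 4 + 6 + (1 + 2 * i))
  gap = solve 1 (λ i → (con 8 :+ i) :* con 6 :+ con 16 :+ con 8 :=
                       con 1 :+ (con 32 :+ (con 8 :+ i) :* con 4 :+ con 6 :+ (con 1 :+ con 2 :* i))) refl

-- The 12 is twice ∑ᵥ q = 6. Eliminating `S` leaves 2n ≤ 20, hence m ≤ 6.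
degree3-arith : ∀ {n m M S} →
  1 + (3 + m) ≡ n → 1 + (9 + M) + 2 ≡ 3 * n →
  S + 6 ≡ 18 + n * 3 → n * 5 + 9 ≤ 12 + S + 5 → m ≤ 6 × M ≡ 3 * m
degree3-arith {m = m} {M} {S} refl M-eq S-eq bound =
  ≮⇒≥ (λ 6<m → m≤n∧m≡1+n+o⇒⊥ (1 + 2 * (m ∸ 7))
    (subst (λ m → (4 + m) * 5 + 9 + 6 ≤ 18 + (4 + m) * 3 + 17) (≡.sym (m+[n∸m]≡n 6<m))
      (≤-trans (+-monoˡ-≤ 6 bound) (≤-reflexive (trans (shift S) (cong (_+ 17) S-eq)))))
    (gap (m ∸ 7)))
  , +-cancelˡ-≡ 12 _ _ (trans (lhs M) (trans M-eq (rhs m)))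
  where
  shift : ∀ S → 12 + S + 5 + 6 ≡ S + 6 + 17
  shift = solve-∀
  gap : ∀ i → (4 + (7 + i)) * 5 + 9 + 6 ≡ suc (18 + (4 + (7 + i)) * 3 + 17 + (1 + 2 * i))
  gap = solve 1 (λ i → (con 4 :+ (con 7 :+ i)) :* con 5 :+ con 9 :+ con 6 :=
                       con 1 :+ (con 18 :+ (con 4 :+ (con 7 :+ i)) :* con 3 :+ con 17 :+ (con 1 :+ con 2 :* i))) refl
  lhs : ∀ M → 12 + M ≡ 1 + (9 + M) + 2
  lhs = solve-∀
  rhs : ∀ m → 3 * (1 + (3 + m)) ≡ 12 + 3 * m
  rhs = solve-∀

degree2-arith : ∀ {n m M} → 1 + (2 + m) ≡ n → 1 + (4 + M) + 2 ≡ 3 * n → M ≡ 2 + 3 * m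
degree2-arith {m = m} {M} refl M-eq = +-cancelˡ-≡ 7 _ _ (trans (lhs M) (trans M-eq (rhs m)))
  where
  lhs : ∀ M → 7 + M ≡ 1 + (4 + M) + 2
  lhs = solve-∀
  rhs : ∀ m → 3 * (1 + (2 + m)) ≡ 7 + (2 + 3 * m)
  rhs = solve-∀

-- Checked by evaluation: the value for degree 3 is unattainable at m = 1, 2, 4, 5, and the one for
-- degree 2 at m = 0, 3, 6.
squareSums-clash : ∀ {m} → m ≤ 6 → 3 * m List.∈ squareSums m m →
  ¬ (2 + 3 * suc m List.∈ squareSums (suc m) (suc m))
squareSums-clash {0} _ _ = from-no (5 ∈? squareSums 1 1)
squareSums-clash {1} _ h = contradiction h (from-no (3 ∈? squareSums 1 1))
squareSums-clash {2} _ h = contradiction h (from-no (6 ∈? squareSums 2 2))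
squareSums-clash {3} _ _ = from-no (14 ∈? squareSums 4 4)
squareSums-clash {4} _ h = contradiction h (from-no (12 ∈? squareSums 4 4))
squareSums-clash {5} _ h = contradiction h (from-no (15 ∈? squareSums 5 5))
squareSums-clash {6} _ _ = from-no (23 ∈? squareSums 7 7)
squareSums-clash {suc (suc (suc (suc (suc (suc (suc _))))))} (s≤s (s≤s (s≤s (s≤s (s≤s (s≤s ())))))) _

layers-clash : ∀ {m M m′ M′} →
  m ≤ 6 → M ≡ 3 * m → M List.∈ squareSums m m →
  m′ ≡ suc m → M′ ≡ 2 + 3 * m′ → ¬ (M′ List.∈ squareSums m′ m′)
layers-clash m≤6 refl M∈ refl refl = squareSums-clash m≤6 M∈

-- The distance function of a connected graph.

module Metric (G : Graph n) (conn : Connected G) where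

  walk? : ∀ k u v → Dec (Walk G u v k)
  walk? zero u v = map′ (λ { refl → here }) (λ { here → refl }) (u ≟ v)
  walk? (suc k) u v =
    map′ (λ { (_ , a , p) → step a p }) (λ { (step a p) → _ , a , p })
         (any? λ x → adj? G u x ×-dec walk? k x v)

  shortest : ∀ u v → ∃ (Dist G u v)
  shortest u v = least (λ k → walk? k u v) (proj₁ (conn u v)) (proj₂ (conn u v))

  d : Fin n → Fin n → ℕ
  d u v = proj₁ (shortest u v)

  d-walk : ∀ u v → Walk G u v (d u v)
  d-walk u v = proj₁ (proj₂ (shortest u v))

  d-min : ∀ {u v m} → Walk G u v m → d u v ≤ m
  d-min {u} {v} {m} = proj₂ (proj₂ (shortest u v)) m

  Dist-d : ∀ u v → Dist G u v (d u v)
  Dist-d u v = proj₂ (shortest u v)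

  Dist⇒≡d : ∀ {u v k} → Dist G u v k → k ≡ d u v
  Dist⇒≡d {u} {v} (walk , k-min) = ≤-antisym (k-min _ (d-walk u v)) (d-min walk)

  d-refl : ∀ u → d u u ≡ 0
  d-refl u = n≤0⇒n≡0 (d-min here)

  d-step : ∀ {u v} w → Adj G u v → d u w ≤ suc (d v w)
  d-step w uv = d-min (step uv (d-walk _ w))

  d-closer : ∀ {u w} → u ≢ w → ∃ λ v → Adj G u v × d u w ≡ suc (d v w)
  d-closer {u} {w} u≢w with d u w | d-walk u w | d-min {u} {w}
  ... | zero  | here              | _     = contradiction refl u≢w
  ... | suc k | step {v = v} uv p | k-min =
    v , uv , ≤-antisym (k-min (step uv (d-walk v w))) (s≤s (d-min p))

  d≡0⇒≡ : ∀ {u w} → d u w ≡ 0 → u ≡ w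
  d≡0⇒≡ {u} {w} eq with d u w | d-walk u w | eq
  ... | zero | here | _ = refl

  d≡1⇒adj : ∀ {u w} → d u w ≡ 1 → Adj G u w
  d≡1⇒adj {u} {w} eq with d u w | d-walk u w | eq
  ... | suc zero | step uv here | _ = uv

  adj⇒≢ : ∀ {u w} → Adj G u w → u ≢ w
  adj⇒≢ uw refl = irrefl G uw

  adj⇒d≡1 : ∀ {u w} → Adj G u w → d u w ≡ 1
  adj⇒d≡1 {u} {w} uw = ≤-antisym (d-min (step uw here)) (n≢0⇒n>0 (adj⇒≢ uw ∘ d≡0⇒≡))

  -- Marks that `v` fails to resolve `x` and `y`. Summed over all `x` and `y` it gives the sum of
  -- the squared sphere sizes around `v`.
  E : Fin n → Fin n → Fin n → ℕ
  E v x y = ⟦ d x v ℕ.≟ d y v ⟧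

-- Double counting of unresolved pairs.

module Randomly3 (G : Graph n) (conn : Connected G) (rd : RandomlyDim G 3) where
  open Metric G conn public

  3≤n : 3 ≤ n
  3≤n with proj₁ (proj₁ rd)
  ... | W , _ , ∣W∣≡3 = subst (_≤ n) ∣W∣≡3 (Subset.∣p∣≤n W)

  ≡d⇒Dist : ∀ {x y w k} → d x w ≡ d y w → Dist G x w k → Dist G y w k
  ≡d⇒Dist {x} {y} {w} eq D = subst (Dist G y w) (≡.sym (trans (Dist⇒≡d D) eq)) (Dist-d y w)

  E-refl : ∀ v x → E v x x ≡ 1
  E-refl v x = ⟦⟧-true (d x v ℕ.≟ d x v) refl

  E-sym : ∀ v x y → E v x y ≡ E v y x
  E-sym v x y = ⟦⟧-cong (d x v ℕ.≟ d y v) (d y v ℕ.≟ d x v) ≡.sym ≡.sym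

  unresolved : Fin n → Fin n → ℕ
  unresolved x y = sum λ v → E v x y

  -- Three vertices failing to resolve `x` and `y` would form a 3-subset that is not resolving.
  unresolved≤2 : ∀ {x y} → x ≢ y → unresolved x y ≤ 2
  unresolved≤2 {x} {y} x≢y = ≮⇒≥ λ 2<c →
    let R? = λ v → d x v ℕ.≟ d y v
        q , q⊆ , ∣q∣≡3 = subset-of-size 3 (tabulate (does ∘ R?)) (subst (3 ≤_) (≡.sym (∣tabulate∣ (does ∘ R?))) 2<c)
        same = λ w w∈q → ∈-tabulate⁻ R? (q⊆ w∈q)
    in x≢y (proj₂ rd q ∣q∣≡3 x y λ w w∈q k → ≡d⇒Dist (same w w∈q) , ≡d⇒Dist (≡.sym (same w w∈q)))

  -- The set of `u` and `v` has at most two elements, too few to be resolving.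
  confused : ∀ u v → ∃ λ x → ∃ λ y → x ≢ y × d x u ≡ d y u × d x v ≡ d y v
  confused u v with any? (λ x → any? λ y → ¬? (x ≟ y) ×-dec (d x u ℕ.≟ d y u ×-dec d x v ℕ.≟ d y v))
  ... | yes found = found
  ... | no none = contradiction (≤-trans (proj₂ (proj₁ rd) (⁅ u ⁆ ∪ ⁅ v ⁆) resolves) size) λ { (s≤s (s≤s ())) }
    where
    size : ∣ ⁅ u ⁆ ∪ ⁅ v ⁆ ∣ ≤ 2
    size = ≤-trans (∣p∪q∣≤∣p∣+∣q∣ ⁅ u ⁆ ⁅ v ⁆) (≤-reflexive (cong₂ _+_ (Subset.∣⁅x⁆∣≡1 u) (Subset.∣⁅x⁆∣≡1 v)))
    resolves : Resolving G (⁅ u ⁆ ∪ ⁅ v ⁆)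
    resolves x y same with x ≟ y
    ... | yes x≡y = x≡y
    ... | no x≢y = contradiction
      (x , y , x≢y , agree u (Subset.x∈p∪q⁺ (inj₁ (Subset.x∈⁅x⁆ u)))
                   , agree v (Subset.x∈p∪q⁺ {p = ⁅ u ⁆} (inj₂ (Subset.x∈⁅x⁆ v)))) none
      where
      agree : ∀ w → w ∈ ⁅ u ⁆ ∪ ⁅ v ⁆ → d x w ≡ d y w
      agree w w∈ = Dist⇒≡d (proj₁ (same w w∈ (d x w)) (Dist-d x w))

  confusions : Fin n → Fin n → ℕ
  confusions u v = sum₂ λ x y → δᶜ x y * (E u x y * E v x y)

  2≤confusions : ∀ u v → 2 ≤ confusions u v
  2≤confusions u v with confused u v
  ... | x , y , x≢y , eu , ev =
    -- The same pair is counted in both orders, in the distinct rows `x` and `y`.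
    ≤-trans (+-mono-≤ (one x≢y eu ev) (one (x≢y ∘ ≡.sym) (≡.sym eu) (≡.sym ev)))
            (two-terms≤sum (λ x → sum λ y → δᶜ x y * (E u x y * E v x y)) x≢y)
    where
    one : ∀ {x y} → x ≢ y → d x u ≡ d y u → d x v ≡ d y v → 1 ≤ sum λ y → δᶜ x y * (E u x y * E v x y)
    one {x} {y} x≢y eu ev =
      ≤-trans (≤-reflexive (≡.sym (cong₂ _*_ (δᶜ≡1 x≢y)
                (cong₂ _*_ (⟦⟧-true (d x u ℕ.≟ d y u) eu) (⟦⟧-true (d x v ℕ.≟ d y v) ev)))))
              (term≤sum (λ y → δᶜ x y * (E u x y * E v x y)) y)

  pairs : Fin n → Fin n → ℕ
  pairs x y = sum₂ λ u v → δᶜ u v * (E u x y * E v x y)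

  -- Splits off the diagonal u = v. With c = `unresolved x y`, it says that `pairs x y` is c(c - 1),
  -- without subtraction.
  unresolved² : ∀ x y → unresolved x y * unresolved x y ≡ unresolved x y + pairs x y
  unresolved² x y = begin
    unresolved x y * unresolved x y             ≡⟨ sum*sum (λ v → E v x y) (λ v → E v x y) ⟩
    sum₂ (λ u v → E u x y * E v x y)            ≡⟨ sum₂-split (λ u v → E u x y * E v x y) ⟩
    sum (λ v → E v x y * E v x y) + pairs x y   ≡⟨ cong (_+ pairs x y) (sum-cong-≗ λ v → ⟦⟧-idem (d x v ℕ.≟ d y v)) ⟩
    unresolved x y + pairs x y                  ∎
    where open ≡-Reasoning

  pairs≤2 : ∀ {x y} → x ≢ y → pairs x y ≤ 2
  pairs≤2 {x} {y} x≢y with unresolved x y | unresolved≤2 x≢y | unresolved² x y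
  ... | 0 | _ | eq = ≤-trans (≤-reflexive (≡.sym eq)) z≤n
  ... | 1 | _ | eq = ≤-trans (≤-reflexive (≡.sym (suc-injective eq))) z≤n
  ... | 2 | _ | eq = ≤-reflexive (≡.sym (suc-injective (suc-injective eq)))
  ... | suc (suc (suc _)) | s≤s (s≤s ()) | _

  -- Both sides count the quadruples with u ≠ v and x ≠ y in which neither `u` nor `v` resolves `x`
  -- and `y`.
  double-count : sum₂ (λ u v → δᶜ u v * confusions u v) ≡ sum₂ (λ x y → δᶜ x y * pairs x y)
  double-count = begin
    sum₂ (λ u v → δᶜ u v * confusions u v)
      ≡⟨ sum₂-cong (λ u v → ≡.sym (sum₂-*ˡ (δᶜ u v) λ x y → δᶜ x y * (E u x y * E v x y))) ⟩
    sum₂ (λ u v → sum₂ λ x y → δᶜ u v * (δᶜ x y * (E u x y * E v x y)))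
      ≡⟨ sum₂-comm (λ u v x y → δᶜ u v * (δᶜ x y * (E u x y * E v x y))) ⟩
    sum₂ (λ x y → sum₂ λ u v → δᶜ u v * (δᶜ x y * (E u x y * E v x y)))
      ≡⟨ sum₂-cong (λ x y → sum₂-cong λ u v → swap (δᶜ u v) (δᶜ x y) (E u x y * E v x y)) ⟩
    sum₂ (λ x y → sum₂ λ u v → δᶜ x y * (δᶜ u v * (E u x y * E v x y)))
      ≡⟨ sum₂-cong (λ x y → sum₂-*ˡ (δᶜ x y) λ u v → δᶜ u v * (E u x y * E v x y)) ⟩
    sum₂ (λ x y → δᶜ x y * pairs x y) ∎
    where
    open ≡-Reasoning
    swap : ∀ a b c → a * (b * c) ≡ b * (a * c)
    swap = solve-∀

  δᶜ*pairs≤δᶜ*2 : ∀ x y → δᶜ x y * pairs x y ≤ δᶜ x y * 2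
  δᶜ*pairs≤δᶜ*2 x y with x ≟ y
  ... | yes _ = z≤n
  ... | no x≢y = *-monoʳ-≤ 1 (pairs≤2 x≢y)

  δᶜ*2≤δᶜ*confusions : ∀ x y → δᶜ x y * 2 ≤ δᶜ x y * confusions x y
  δᶜ*2≤δᶜ*confusions x y = *-monoʳ-≤ (δᶜ x y) (2≤confusions x y)

  -- Off the diagonal `pairs` is at most 2 and `confusions` at least 2, but their totals agree, so
  -- every term is 2.
  pairs≡2 : ∀ {x y} → x ≢ y → pairs x y ≡ 2
  pairs≡2 {x} {y} x≢y = *-cancelˡ-≡ _ _ 1 (subst (λ e → e * pairs x y ≡ e * 2) (δᶜ≡1 x≢y)
    (sum₂-tight δᶜ*pairs≤δᶜ*2 (≤-trans (sum₂-mono δᶜ*2≤δᶜ*confusions) (≤-reflexive double-count)) x y))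

  confusions≡2 : ∀ {u v} → u ≢ v → confusions u v ≡ 2
  confusions≡2 {x} {y} x≢y = *-cancelˡ-≡ _ _ 1 (subst (λ e → e * confusions x y ≡ e * 2) (δᶜ≡1 x≢y)
    (≡.sym (sum₂-tight δᶜ*2≤δᶜ*confusions (≤-trans (≤-reflexive double-count) (sum₂-mono δᶜ*pairs≤δᶜ*2)) x y)))

  -- The count c satisfies c² = c + 2, whose only natural solution is 2.
  unresolved≡2 : ∀ {x y} → x ≢ y → unresolved x y ≡ 2
  unresolved≡2 {x} {y} x≢y with unresolved x y | unresolved≤2 x≢y | trans (unresolved² x y) (cong (unresolved x y +_) (pairs≡2 x≢y))
  ... | 0 | _ | ()
  ... | 1 | _ | ()
  ... | 2 | _ | _ = refl
  ... | suc (suc (suc _)) | s≤s (s≤s ()) | _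

  -- This is 2 + (n - 2)δ with the subtraction moved across: all `n` vertices fail on the diagonal.
  unresolved-eq : ∀ x y → unresolved x y + 2 * δ x y ≡ 2 + n * δ x y
  unresolved-eq x y with x ≟ y
  ... | yes refl = trans (cong (_+ 2) (trans (sum-cong-≗ λ v → E-refl v x) (sum-const n 1))) (+-comm _ 2)
  ... | no x≢y = cong₂ _+_ (unresolved≡2 x≢y) (≡.sym (*-zeroʳ n))

  -- Let `X` count the ordered pairs x ≠ y that `w` fails to resolve. Counting with them a vertex
  -- `v` that also fails gives 2X by pairs. By vertices it gives X for v = w and 2 for each other
  -- `v`. Hence X = 2n - 2, and the diagonal adds `n`.
  sum₂-E : ∀ w → sum₂ (E w) + 2 ≡ 3 * n
  sum₂-E w = begin
    sum₂ (E w) + 2 ≡⟨ cong (_+ 2) (sum₂-split (E w)) ⟩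
    sum (λ x → E w x x) + X + 2 ≡⟨ cong (λ s → s + X + 2) (trans (sum-cong-≗ (E-refl w)) (trans (sum-const n 1) (*-identityʳ n))) ⟩
    n + X + 2 ≡⟨ +-assoc n X 2 ⟩
    n + (X + 2) ≡⟨ cong (n +_) (+-cancelʳ-≡ X (X + 2) (2 * n) X-eq) ⟩
    3 * n ∎
    where
    open ≡-Reasoning
    X = sum₂ λ x y → δᶜ x y * E w x y
    regroup : ∀ x → x + 2 + x ≡ 2 * x + 2
    regroup = solve-∀
    -- The δ terms exchange the exceptional value `X` at v = w for the generic value 2.
    term : ∀ v → confusions w v + δ w v * 2 ≡ 2 + δ w v * X
    term v with w ≟ v
    ... | yes refl = trans (cong (_+ 2) (sum₂-cong λ x y → cong (δᶜ x y *_) (⟦⟧-idem (d x w ℕ.≟ d y w)))) (trans (+-comm X 2) (cong (2 +_) (≡.sym (*-identityˡ X))))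
    ... | no w≢v = cong (_+ 0) (confusions≡2 w≢v)
    δᶜ-unresolved : ∀ x y → 2 * (δᶜ x y * E w x y) ≡ sum λ v → δᶜ x y * (E w x y * E v x y)
    δᶜ-unresolved x y with x ≟ y
    ... | yes _ = ≡.sym (sum-zero {n} λ v → refl)
    ... | no x≢y = begin
      2 * (1 * E w x y)                     ≡⟨ cong (2 *_) (*-identityˡ (E w x y)) ⟩
      2 * E w x y                           ≡⟨ *-comm 2 (E w x y) ⟩
      E w x y * 2                           ≡⟨ cong (E w x y *_) (unresolved≡2 x≢y) ⟨
      E w x y * unresolved x y              ≡⟨ *-distribˡ-sum (E w x y) (λ v → E v x y) ⟩
      sum (λ v → E w x y * E v x y)         ≡⟨ sum-cong-≗ (λ v → *-identityˡ (E w x y * E v x y)) ⟨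
      sum (λ v → 1 * (E w x y * E v x y))   ∎
    X-eq : X + 2 + X ≡ 2 * n + X
    X-eq = begin
      X + 2 + X                                      ≡⟨ regroup X ⟩
      2 * X + 2                                      ≡⟨ cong (_+ 2) (sum₂-*ˡ 2 (λ x y → δᶜ x y * E w x y)) ⟨
      sum₂ (λ x y → 2 * (δᶜ x y * E w x y)) + 2      ≡⟨ cong (_+ 2) (sum₂-cong δᶜ-unresolved) ⟩
      sum₂ (λ x y → sum λ v → δᶜ x y * (E w x y * E v x y)) + 2 ≡⟨ cong (_+ 2) (sum₂-sum λ x y v → δᶜ x y * (E w x y * E v x y)) ⟩
      sum (confusions w) + 2                         ≡⟨ cong (sum (confusions w) +_) (sum-δ* w (λ _ → 2)) ⟨
      sum (confusions w) + sum (λ v → δ w v * 2)     ≡⟨ ∑-distrib-+ (confusions w) (λ v → δ w v * 2) ⟨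
      sum (λ v → confusions w v + δ w v * 2)         ≡⟨ sum-cong-≗ term ⟩
      sum (λ v → 2 + δ w v * X)                      ≡⟨ ∑-distrib-+ (λ _ → 2) (λ v → δ w v * X) ⟩
      sum {n} (λ _ → 2) + sum (λ v → δ w v * X)      ≡⟨ cong₂ _+_ (trans (sum-const n 2) (*-comm n 2)) (sum-δ* w (λ _ → X)) ⟩
      2 * n + X                                      ∎

-- Neighbours classified by distance to another vertex.

module Degrees (G : Graph n) (conn : Connected G) (rd : RandomlyDim G 3) where
  open Randomly3 G conn rd public

  a : Fin n → Fin n → ℕ
  a w y = ⟦ adj? G w y ⟧

  deg : Fin n → ℕ
  deg w = sum (a w)

  degree≡deg : ∀ w → degree G w ≡ deg w
  degree≡deg w = ∣tabulate∣ λ y → does (adj? G w y)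

  adj-near : ∀ {w y} v → Adj G w y → Near (d y v) (d w v)
  adj-near v wy = near (d-step v (sym G wy)) (d-step v wy)

  p q r : Fin n → Fin n → ℕ
  p w v = sum λ y → a w y * lo (d w v) (d y v)
  q w v = sum λ y → a w y * eq (d w v) (d y v)
  r w v = sum λ y → a w y * hi (d w v) (d y v)

  p+q+r≡deg : ∀ w v → p w v + q w v + r w v ≡ deg w
  p+q+r≡deg w v = begin
    p w v + q w v + r w v  ≡⟨ cong (_+ r w v) (∑-distrib-+ (λ y → a w y * lo (d w v) (d y v)) (λ y → a w y * eq (d w v) (d y v))) ⟨
    sum (λ y → a w y * lo (d w v) (d y v) + a w y * eq (d w v) (d y v)) + r w v
      ≡⟨ ∑-distrib-+ (λ y → a w y * lo (d w v) (d y v) + a w y * eq (d w v) (d y v)) (λ y → a w y * hi (d w v) (d y v)) ⟨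
    sum (λ y → a w y * lo (d w v) (d y v) + a w y * eq (d w v) (d y v) + a w y * hi (d w v) (d y v)) ≡⟨ sum-cong-≗ term ⟩
    deg w ∎
    where
    open ≡-Reasoning
    drop1* : ∀ x y z → 1 * x + 1 * y + 1 * z ≡ x + y + z
    drop1* = solve-∀
    term : ∀ y → a w y * lo (d w v) (d y v) + a w y * eq (d w v) (d y v) + a w y * hi (d w v) (d y v) ≡ a w y
    term y with adj? G w y
    ... | yes wy = trans (drop1* (lo (d w v) (d y v)) (eq (d w v) (d y v)) (hi (d w v) (d y v))) (lo+eq+hi≡1 (adj-near v wy))
    ... | no _ = refl

  -- The classes are the fibres of the distance to `v` on the neighbours of `w`, so squaring their
  -- sizes counts the ordered pairs of neighbours that `v` fails to resolve.
  sumSq-pqr : ∀ w v → sumSq (p w v) (q w v) (r w v) ≡ sum₂ λ y z → a w y * a w z * E v y z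
  sumSq-pqr w v = begin
    p w v * p w v + q w v * q w v + r w v * r w v
      ≡⟨ cong₂ _+_ (cong₂ _+_ (sum*sum A A) (sum*sum B B)) (sum*sum C C) ⟩
    sum₂ (λ y z → A y * A z) + sum₂ (λ y z → B y * B z) + sum₂ (λ y z → C y * C z)
      ≡⟨ cong (_+ sum₂ (λ y z → C y * C z)) (sum₂-+ (λ y z → A y * A z) (λ y z → B y * B z)) ⟨
    sum₂ (λ y z → A y * A z + B y * B z) + sum₂ (λ y z → C y * C z)
      ≡⟨ sum₂-+ (λ y z → A y * A z + B y * B z) (λ y z → C y * C z) ⟨
    sum₂ (λ y z → A y * A z + B y * B z + C y * C z) ≡⟨ sum₂-cong term ⟩
    sum₂ (λ y z → a w y * a w z * E v y z) ∎
    where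
    open ≡-Reasoning
    t = d w v
    A B C : Fin n → ℕ
    A y = a w y * lo t (d y v)
    B y = a w y * eq t (d y v)
    C y = a w y * hi t (d y v)
    factor : ∀ l e h k l′ e′ h′ →
      1 * l * (k * l′) + 1 * e * (k * e′) + 1 * h * (k * h′) ≡ 1 * k * (l * l′ + e * e′ + h * h′)
    factor = solve-∀
    term : ∀ y z → A y * A z + B y * B z + C y * C z ≡ a w y * a w z * E v y z
    term y z with adj? G w y
    ... | no _ = refl
    ... | yes wy = trans (factor (lo t (d y v)) (eq t (d y v)) (hi t (d y v)) (a w z) (lo t (d z v)) (eq t (d z v)) (hi t (d z v)))
                         (cong (1 * a w z *_) (≡.sym (⟦≟⟧-near (adj-near v wy) (d z v))))

  -- Summing over `v` first, a pair of distinct neighbours contributes 2 and an equal pair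
  -- contributes `n`, as in `unresolved-eq`.
  sum-sumSq : ∀ w → sum (λ v → sumSq (p w v) (q w v) (r w v)) + 2 * deg w ≡ 2 * (deg w * deg w) + n * deg w
  sum-sumSq w = begin
    sum (λ v → sumSq (p w v) (q w v) (r w v)) + 2 * deg w
      ≡⟨ cong₂ _+_ (trans (sum-cong-≗ (sumSq-pqr w)) (≡.sym (sum₂-sum λ y z v → a w y * a w z * E v y z)))
                   (≡.sym (diag 2)) ⟩
    sum₂ (λ y z → sum λ v → a w y * a w z * E v y z) + sum₂ (λ y z → a w y * a w z * (2 * δ y z))
      ≡⟨ cong (_+ sum₂ (λ y z → a w y * a w z * (2 * δ y z))) (sum₂-cong λ y z → ≡.sym (*-distribˡ-sum (a w y * a w z) λ v → E v y z)) ⟩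
    sum₂ (λ y z → a w y * a w z * unresolved y z) + sum₂ (λ y z → a w y * a w z * (2 * δ y z))
      ≡⟨ sum₂-+ (λ y z → a w y * a w z * unresolved y z) (λ y z → a w y * a w z * (2 * δ y z)) ⟨
    sum₂ (λ y z → a w y * a w z * unresolved y z + a w y * a w z * (2 * δ y z))
      ≡⟨ sum₂-cong (λ y z → trans (≡.sym (*-distribˡ-+ (a w y * a w z) (unresolved y z) (2 * δ y z)))
           (trans (cong (a w y * a w z *_) (unresolved-eq y z)) (*-distribˡ-+ (a w y * a w z) 2 (n * δ y z)))) ⟩
    sum₂ (λ y z → a w y * a w z * 2 + a w y * a w z * (n * δ y z))
      ≡⟨ sum₂-+ (λ y z → a w y * a w z * 2) (λ y z → a w y * a w z * (n * δ y z)) ⟩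
    sum₂ (λ y z → a w y * a w z * 2) + sum₂ (λ y z → a w y * a w z * (n * δ y z))
      ≡⟨ cong₂ _+_ (trans (sum₂-cong λ y z → *-comm (a w y * a w z) 2)
                     (trans (sum₂-*ˡ 2 λ y z → a w y * a w z) (cong (2 *_) (≡.sym (sum*sum (a w) (a w))))))
                   (diag n) ⟩
    2 * (deg w * deg w) + n * deg w ∎
    where
    open ≡-Reasoning
    rearrange : ∀ x y c e → x * y * (c * e) ≡ c * (e * (x * y))
    rearrange = solve-∀
    diag : ∀ c → sum₂ (λ y z → a w y * a w z * (c * δ y z)) ≡ c * deg w
    diag c = trans (sum₂-cong λ y z → rearrange (a w y) (a w z) c (δ y z))
      (trans (sum₂-*ˡ c λ y z → δ y z * (a w y * a w z))
        (cong (c *_) (trans (sum₂-δ* λ y z → a w y * a w z) (sum-cong-≗ λ y → ⟦⟧-idem (adj? G w y)))))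

  -- After exchanging the sums, each neighbour `y` contributes the number of vertices that fail to
  -- resolve `y` and `w`, which is 2.
  sum-q : ∀ w → sum (q w) ≡ 2 * deg w
  sum-q w = begin
    sum (q w)                                                ≡⟨ ∑-comm (λ v y → a w y * E v y w) ⟩
    sum (λ y → sum λ v → a w y * E v y w)                    ≡⟨ sum-cong-≗ (λ y → ≡.sym (*-distribˡ-sum (a w y) λ v → E v y w)) ⟩
    sum (λ y → a w y * unresolved y w)                       ≡⟨ sum-cong-≗ term ⟩
    sum (λ y → 2 * a w y)                                    ≡⟨ *-distribˡ-sum 2 (a w) ⟨
    2 * deg w                                                ∎
    where
    open ≡-Reasoning
    term : ∀ y → a w y * unresolved y w ≡ 2 * a w y
    term y with adj? G w y
    ... | yes wy = trans (*-identityˡ _) (unresolved≡2 (adj⇒≢ wy ∘ ≡.sym))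
    ... | no _ = refl

  1≤p : ∀ {w v} → w ≢ v → 1 ≤ p w v
  1≤p {w} {v} w≢v with d-closer w≢v
  ... | y , wy , closer =
    ≤-trans (≤-reflexive (≡.sym (cong₂ _*_ (⟦⟧-true (adj? G w y) wy) (⟦⟧-true (suc (d y v) ℕ.≟ d w v) (≡.sym closer)))))
            (term≤sum (λ y → a w y * lo (d w v) (d y v)) y)

  p-self : ∀ w → p w w ≡ 0
  p-self w = sum-zero λ y → trans (cong (a w y *_) (⟦⟧-false (suc (d y w) ℕ.≟ d w w) λ e → 1+n≢0 (trans e (d-refl w)))) (*-zeroʳ (a w y))

  q-self : ∀ w → q w w ≡ 0
  q-self w = sum-zero term
    where
    term : ∀ y → a w y * eq (d w w) (d y w) ≡ 0
    term y with adj? G w y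
    ... | no _ = refl
    ... | yes wy = trans (*-identityˡ _) (⟦⟧-false (d y w ℕ.≟ d w w) λ e →
      1+n≢0 (trans (≡.sym (adj⇒d≡1 (sym G wy))) (trans e (d-refl w))))

  r-self : ∀ w → r w w ≡ deg w
  r-self w = trans (cong (_+ r w w) (≡.sym (cong₂ _+_ (p-self w) (q-self w)))) (p+q+r≡deg w w)

  -- The split at v = w is exactly (0, 0, `deg w`), and the bound `c` applies at the other n - 1
  -- vertices. The `c` added on the right replaces that subtraction.
  sum-pqr-bound : ∀ w (F : ℕ → ℕ → ℕ → ℕ) c →
    (∀ p q r → p + q + r ≡ deg w → 1 ≤ p → c ≤ F p q r) →
    n * c + F 0 0 (deg w) ≤ sum (λ v → F (p w v) (q w v) (r w v)) + c
  sum-pqr-bound w F c c≤F = begin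
    n * c + F 0 0 (deg w)
      ≡⟨ cong₂ _+_ (sum-const n c) (sum-δ* w (λ _ → F 0 0 (deg w))) ⟨
    sum {n} (λ _ → c) + sum (λ v → δ w v * F 0 0 (deg w))
      ≡⟨ ∑-distrib-+ (λ _ → c) (λ v → δ w v * F 0 0 (deg w)) ⟨
    sum (λ v → c + δ w v * F 0 0 (deg w))
      ≤⟨ sum-mono term ⟩
    sum (λ v → F (p w v) (q w v) (r w v) + δ w v * c)
      ≡⟨ ∑-distrib-+ (λ v → F (p w v) (q w v) (r w v)) (λ v → δ w v * c) ⟩
    sum (λ v → F (p w v) (q w v) (r w v)) + sum (λ v → δ w v * c)
      ≡⟨ cong (sum (λ v → F (p w v) (q w v) (r w v)) +_) (sum-δ* w (λ _ → c)) ⟩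
    sum (λ v → F (p w v) (q w v) (r w v)) + c ∎
    where
    open ≤-Reasoning
    swap : ∀ c f → c + 1 * f ≡ f + 1 * c
    swap = solve-∀
    term : ∀ v → c + δ w v * F 0 0 (deg w) ≤ F (p w v) (q w v) (r w v) + δ w v * c
    term v with w ≟ v
    ... | yes refl rewrite p-self w | q-self w | r-self w = ≤-reflexive (swap c (F 0 0 (deg w)))
    ... | no w≢v = +-monoˡ-≤ 0 (c≤F _ _ _ (p+q+r≡deg w v) (1≤p w≢v))

  adj⇒1≤a : ∀ {w y} → Adj G w y → 1 ≤ a w y
  adj⇒1≤a {w} {y} wy = ≤-reflexive (≡.sym (⟦⟧-true (adj? G w y) wy))

  another : (y : Fin n) → ∃ λ x → y ≢ x
  another = other 3≤n
    where
    other : ∀ {n} → 3 ≤ n → (y : Fin n) → ∃ λ x → y ≢ x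
    other (s≤s (s≤s _)) zero    = suc zero , λ ()
    other (s≤s (s≤s _)) (suc y) = zero , λ ()

  -- Every shortest path leaving `y` would start through `z`, so `y` and `z` would have different
  -- distances to every vertex, whereas two vertices must fail to resolve them.
  no-pendant : ∀ {y z} → Adj G y z → ¬ (∀ {t} → Adj G y t → t ≡ z)
  no-pendant {y} {z} yz only =
    1+n≢0 (trans (≡.sym (unresolved≡2 (adj⇒≢ yz))) (sum-zero λ v → ⟦⟧-false (d y v ℕ.≟ d z v) (resolved v)))
    where
    resolved : ∀ v → d y v ≢ d z v
    resolved v e with y ≟ v
    ... | yes refl = 1+n≢0 (trans (≡.sym (adj⇒d≡1 (sym G yz))) (trans (≡.sym e) (d-refl y)))
    ... | no y≢v with d-closer y≢v
    ...   | t , yt , closer = 1+n≢n (trans (≡.sym (subst (λ t → d y v ≡ suc (d t v)) (only yt) closer)) e)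

  2≤deg : ∀ y → 2 ≤ deg y
  2≤deg y with d-closer (proj₂ (another y))
  ... | z , yz , _ = ≮⇒≥ λ deg<2 → no-pendant yz λ {t} yt → decidable-stable (t ≟ z) λ t≢z →
    <⇒≱ deg<2 (≤-trans (+-mono-≤ (adj⇒1≤a yt) (adj⇒1≤a yz)) (two-terms≤sum (a y) t≢z))

  -- Spheres around a vertex.

  count : Fin n → ℕ → ℕ
  count w j = sum λ x → ⟦ d x w ℕ.≟ j ⟧

  count-0 : ∀ w → count w 0 ≡ 1
  count-0 w = trans (sum-cong-≗ λ x → ⟦⟧-cong (d x w ℕ.≟ 0) (w ≟ x) (≡.sym ∘ d≡0⇒≡) λ { refl → d-refl w }) (sum-δ w)

  count-1 : ∀ w → count w 1 ≡ deg w
  count-1 w = sum-cong-≗ λ x → ⟦⟧-cong (d x w ℕ.≟ 1) (adj? G w x) (sym G ∘ d≡1⇒adj) (adj⇒d≡1 ∘ sym G)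

  -- Any bound on the distances to w would do; it makes the layers a finite family.
  height : Fin n → ℕ
  height w = sum λ x → d x w

  -- Indexing starts at radius 2, because radii 0 and 1 have the known sizes 1 and `deg w`.
  layer : (w : Fin n) → Fin (suc (height w)) → ℕ
  layer w i = count w (2 + toℕ i)

  d<3+height : ∀ w x → d x w < 3 + height w
  d<3+height w x = s≤s (≤-trans (term≤sum (λ x → d x w) x) (m≤n+m _ 2))

  sum-layer : ∀ w → 1 + (deg w + sum (layer w)) ≡ n
  sum-layer w = begin
    1 + (deg w + sum (layer w))                       ≡⟨ cong₂ (λ c₀ c₁ → c₀ + (c₁ + sum (layer w))) (count-0 w) (count-1 w) ⟨
    sum {L} (λ i → count w (toℕ i))                   ≡⟨ ∑-comm {L} (λ i x → ⟦ d x w ℕ.≟ toℕ i ⟧) ⟩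
    sum (λ x → sum {L} λ i → ⟦ d x w ℕ.≟ toℕ i ⟧)     ≡⟨ sum-cong-≗ (λ x → trans (sum-cong-≗ {L} λ i → ≡.sym (*-identityʳ ⟦ d x w ℕ.≟ toℕ i ⟧)) (sum-toℕ (d<3+height w x) (λ _ → 1))) ⟩
    sum {n} (λ _ → 1)                                 ≡⟨ trans (sum-const n 1) (*-identityʳ n) ⟩
    n                                                 ∎
    where
    open ≡-Reasoning
    L = 3 + height w

  -- Squared sphere sizes count ordered pairs on a common sphere, which `sum₂-E` evaluates.
  sum-layer² : ∀ w → 1 + (deg w * deg w + sum (λ i → layer w i * layer w i)) + 2 ≡ 3 * n
  sum-layer² w = trans (cong (_+ 2) (begin
    1 + (deg w * deg w + sum (λ i → layer w i * layer w i))
      ≡⟨ cong₂ (λ c₀ c₁ → c₀ * c₀ + (c₁ * c₁ + sum (λ i → layer w i * layer w i))) (count-0 w) (count-1 w) ⟨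
    sum {L} (λ i → count w (toℕ i) * count w (toℕ i))
      ≡⟨ sum-cong-≗ {L} (λ i → sum*sum (λ x → ⟦ d x w ℕ.≟ toℕ i ⟧) (λ y → ⟦ d y w ℕ.≟ toℕ i ⟧)) ⟩
    sum {L} (λ i → sum₂ λ x y → ⟦ d x w ℕ.≟ toℕ i ⟧ * ⟦ d y w ℕ.≟ toℕ i ⟧)
      ≡⟨ sum₂-sum {m = L} (λ x y i → ⟦ d x w ℕ.≟ toℕ i ⟧ * ⟦ d y w ℕ.≟ toℕ i ⟧) ⟨
    sum₂ (λ x y → sum {L} λ i → ⟦ d x w ℕ.≟ toℕ i ⟧ * ⟦ d y w ℕ.≟ toℕ i ⟧)
      ≡⟨ sum₂-cong (λ x y → trans (sum-toℕ (d<3+height w x) (λ j → ⟦ d y w ℕ.≟ j ⟧)) (E-sym w y x)) ⟩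
    sum₂ (E w) ∎)) (sum₂-E w)
    where
    open ≡-Reasoning
    L = 3 + height w

-- Elimination of all degrees other than 3.

module Regularity (G : Graph n) (conn : Connected G) (rd : RandomlyDim G 3) where
  open Degrees G conn rd public

  layer² : (w : Fin n) → ℕ
  layer² w = sum λ i → layer w i * layer w i

  S : Fin n → ℕ
  S w = sum λ v → sumSq (p w v) (q w v) (r w v)

  sum-layer≤layer² : ∀ w → sum (layer w) ≤ layer² w
  sum-layer≤layer² w = sum-mono λ i → ≤-square (layer w i)

  deg≤4 : ∀ w → deg w ≤ 4
  deg≤4 w = ≮⇒≥ λ 5≤k → degree≥5-arith (deg w ∸ 5)
    (subst (λ k → 1 + (k + sum (layer w)) ≡ n) (k≡ 5≤k) (sum-layer w))
    (subst (λ k → 1 + (k * k + layer² w) + 2 ≡ 3 * n) (k≡ 5≤k) (sum-layer² w))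
    (sum-layer≤layer² w)
    (subst (λ k → S w + 2 * k ≡ 2 * (k * k) + n * k) (k≡ 5≤k) (sum-sumSq w))
    (subst (λ k → n * (k * k) + 3 * (k * k) ≤ 3 * S w + k * k) (k≡ 5≤k) bound)
    where
    k≡ : 5 ≤ deg w → deg w ≡ 5 + (deg w ∸ 5)
    k≡ 5≤k = ≡.sym (m+[n∸m]≡n 5≤k)
    -- Cauchy-Schwarz for three classes; the factor 3 stays inside the summand to avoid division.
    bound : n * (deg w * deg w) + 3 * (deg w * deg w) ≤ 3 * S w + deg w * deg w
    bound = ≤-trans
      (sum-pqr-bound w (λ p q r → 3 * sumSq p q r) (deg w * deg w)
        λ p q r eq _ → subst (λ k → k * k ≤ 3 * sumSq p q r) eq ([p+q+r]²≤3sumSq p q r))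
      (≤-reflexive (cong (_+ deg w * deg w) (sum-*ˡ 3 λ v → sumSq (p w v) (q w v) (r w v))))

  -- At distance at least 3 the closed neighbourhoods of `y` and `w` are disjoint.
  far-deg : ∀ {w y} → 3 ≤ d y w → deg y + (1 + (1 + deg w)) ≤ n
  far-deg {w} {y} 3≤d = begin
    deg y + (1 + (1 + deg w))                              ≡⟨ cong (deg y +_) (cong₂ (λ s t → s + (t + deg w)) (sum-δ y) (sum-δ w)) ⟨
    deg y + (sum (δ y) + (sum (δ w) + deg w))              ≡⟨ cong (λ s → deg y + (sum (δ y) + s)) (∑-distrib-+ (δ w) (a w)) ⟨
    deg y + (sum (δ y) + sum (λ z → δ w z + a w z))        ≡⟨ cong (deg y +_) (∑-distrib-+ (δ y) (λ z → δ w z + a w z)) ⟨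
    deg y + sum (λ z → δ y z + (δ w z + a w z))            ≡⟨ ∑-distrib-+ (a y) (λ z → δ y z + (δ w z + a w z)) ⟨
    sum (λ z → a y z + (δ y z + (δ w z + a w z)))          ≤⟨ sum-mono term ⟩
    sum {n} (λ _ → 1)                                      ≡⟨ trans (sum-const n 1) (*-identityʳ n) ⟩
    n                                                      ∎
    where
    open ≤-Reasoning
    distant : ∀ {z} → 2 ≤ d z w → δ w z + a w z ≡ 0
    distant {z} 2≤d = cong₂ _+_
      (⟦⟧-false (w ≟ z) λ { refl → contradiction (subst (2 ≤_) (d-refl w) 2≤d) λ () })
      (⟦⟧-false (adj? G w z) λ wz → contradiction (subst (2 ≤_) (adj⇒d≡1 (sym G wz)) 2≤d) λ { (s≤s ()) })
    ball : ∀ z → δ w z + a w z ≤ 1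
    ball z with w ≟ z
    ... | yes refl = ≤-reflexive (cong suc (⟦⟧-false (adj? G w w) (irrefl G)))
    ... | no _ with adj? G w z
    ...   | yes _ = ≤-refl
    ...   | no _  = z≤n
    term : ∀ z → a y z + (δ y z + (δ w z + a w z)) ≤ 1
    term z with y ≟ z
    ... | yes refl = ≤-reflexive (cong₂ (λ s t → s + (1 + t)) (⟦⟧-false (adj? G y y) (irrefl G)) (distant (≤-trans (n≤1+n 2) 3≤d)))
    ... | no _ with adj? G y z
    ...   | yes yz = ≤-reflexive (cong suc (distant (s≤s⁻¹ (≤-trans 3≤d (d-step w yz)))))
    ...   | no _   = ball z

  deg≢4 : ∀ w → deg w ≢ 4
  deg≢4 w k≡4 with degree4-arith sum-eq
      (subst (λ k → 1 + (k * k + layer² w) + 2 ≡ 3 * n) k≡4 (sum-layer² w))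
      (sum-layer≤layer² w)
      (subst (λ k → S w + 2 * k ≡ 2 * (k * k) + n * k) k≡4 (sum-sumSq w))
      (subst (λ k → n * 6 + k * k ≤ S w + 6) k≡4 (sum-pqr-bound w sumSq 6 λ p q r eq _ → six p q r (trans eq k≡4)))
    where
    sum-eq : 1 + (4 + sum (layer w)) ≡ n
    sum-eq = subst (λ k → 1 + (k + sum (layer w)) ≡ n) k≡4 (sum-layer w)
    -- Three times the sum of squares is at least 16, hence exceeds 3 · 5.
    six : ∀ p q r → p + q + r ≡ 4 → 6 ≤ sumSq p q r
    six p q r eq = *-cancelˡ-< 3 5 _ (subst (λ k → k * k ≤ 3 * sumSq p q r) eq ([p+q+r]²≤3sumSq p q r))
  ... | m≡2 , M≡2 with any? (λ y → 3 ℕ.≤? d y w)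
  -- Here n = 7, and the disjoint closed neighbourhoods leave `y` degree at most 1.
  ...   | yes (y , 3≤d) = <⇒≱ (+-monoˡ-< 6 (2≤deg y))
          (subst (deg y + 6 ≤_) n≡7 (subst (λ k → deg y + (1 + (1 + k)) ≤ n) k≡4 (far-deg 3≤d)))
    where
    n≡7 : n ≡ 7
    n≡7 = trans (≡.sym (sum-layer w)) (cong₂ (λ k m → 1 + (k + m)) k≡4 m≡2)
  -- Otherwise both remaining vertices lie at distance 2, and the squares sum to 4 instead of 2.
  ...   | no near-all = contradiction (trans (≡.sym M≡4) M≡2) λ ()
    where
    empty : ∀ i → layer w (suc i) ≡ 0
    empty i = sum-zero λ x → ⟦⟧-false (d x w ℕ.≟ 3 + toℕ i) λ e → near-all (x , subst (3 ≤_) (≡.sym e) (m≤m+n 3 _))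
    first≡2 : layer w zero ≡ 2
    first≡2 = trans (≡.sym (trans (cong (layer w zero +_) (sum-zero empty)) (+-identityʳ _))) m≡2
    M≡4 : layer² w ≡ 4
    M≡4 = cong₂ _+_ (cong₂ _*_ first≡2 first≡2) (sum-zero λ i → cong₂ _*_ (empty i) (empty i))

  deg3-layers : ∀ {w} → deg w ≡ 3 → sum (layer w) ≤ 6 × layer² w ≡ 3 * sum (layer w)
  deg3-layers {w} k≡3 = degree3-arith
    (subst (λ k → 1 + (k + sum (layer w)) ≡ n) k≡3 (sum-layer w))
    (subst (λ k → 1 + (k * k + layer² w) + 2 ≡ 3 * n) k≡3 (sum-layer² w))
    (subst (λ k → S w + 2 * k ≡ 2 * (k * k) + n * k) k≡3 (sum-sumSq w))
    (≤-trans (subst (λ k → n * 5 + k * k ≤ total + 5) k≡3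
               (sum-pqr-bound w (λ p q r → 2 * q + sumSq p q r) 5 λ p q r eq 1≤p → 5≤2q+sumSq p q r (trans eq k≡3) 1≤p))
             (≤-reflexive (cong (_+ 5) total≡)))
    where
    total = sum λ v → 2 * q w v + sumSq (p w v) (q w v) (r w v)
    total≡ : total ≡ 12 + S w
    total≡ = trans (∑-distrib-+ (λ v → 2 * q w v) (λ v → sumSq (p w v) (q w v) (r w v)))
      (cong (_+ S w) (trans (sum-*ˡ 2 (q w)) (cong (2 *_) (trans (sum-q w) (cong (2 *_) k≡3)))))

  deg2-layers : ∀ {w} → deg w ≡ 2 → layer² w ≡ 2 + 3 * sum (layer w)
  deg2-layers {w} k≡2 = degree2-arith
    (subst (λ k → 1 + (k + sum (layer w)) ≡ n) k≡2 (sum-layer w))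
    (subst (λ k → 1 + (k * k + layer² w) + 2 ≡ 3 * n) k≡2 (sum-layer² w))

  layer²∈squareSums : ∀ w → layer² w List.∈ squareSums (sum (layer w)) (sum (layer w))
  layer²∈squareSums w = ∈-squareSums (layer w) _ ≤-refl

  -- Both vertices see the same `n`, so beyond its closed neighbourhood `w` has one vertex more than
  -- `u`; the finite check on sums of squares then applies.
  no-mixed-degrees : ∀ {u w} → deg u ≡ 3 → deg w ≢ 2
  no-mixed-degrees {u} {w} u≡3 w≡2 = layers-clash
    (proj₁ (deg3-layers u≡3)) (proj₂ (deg3-layers u≡3)) (layer²∈squareSums u)
    m′≡ (deg2-layers w≡2) (layer²∈squareSums w)
    where
    m′≡ : sum (layer w) ≡ suc (sum (layer u))
    m′≡ = +-cancelˡ-≡ 3 _ _ (trans (subst (λ k → 1 + (k + sum (layer w)) ≡ n) w≡2 (sum-layer w))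
                             (≡.sym (subst (λ k → 1 + (k + sum (layer u)) ≡ n) u≡3 (sum-layer u))))

  -- Read an edge from its other end: `y` is closer to `v` than `w` exactly when `w` is farther from
  -- `v` than `y`.
  sum₂-p≡sum₂-r : sum₂ p ≡ sum₂ r
  sum₂-p≡sum₂-r = begin
    sum (λ w → sum λ v → sum λ y → a w y * lo (d w v) (d y v))   ≡⟨ sum-cong-≗ (λ w → ∑-comm λ v y → a w y * lo (d w v) (d y v)) ⟩
    sum₂ (λ w y → sum λ v → a w y * lo (d w v) (d y v))          ≡⟨ ∑-comm (λ w y → sum λ v → a w y * lo (d w v) (d y v)) ⟩
    sum₂ (λ y w → sum λ v → a w y * lo (d w v) (d y v))          ≡⟨ sum₂-cong (λ y w → sum-cong-≗ λ v → cong₂ _*_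
                                                                      (⟦⟧-cong (adj? G w y) (adj? G y w) (sym G) (sym G))
                                                                      (⟦⟧-cong (suc (d y v) ℕ.≟ d w v) (d w v ℕ.≟ suc (d y v)) ≡.sym ≡.sym)) ⟩
    sum₂ (λ y w → sum λ v → a y w * hi (d y v) (d w v))          ≡⟨ sum-cong-≗ (λ y → ∑-comm λ w v → a y w * hi (d y v) (d w v)) ⟩
    sum₂ r                                                       ∎
    where open ≡-Reasoning

  -- For v ≠ w, p ≥ 1 leaves r + q ≤ 1 ≤ p; at v = w the left side is 2 and p is 0. Summing costs 2
  -- in total, while ∑ᵥ q = 4.
  sum-r+2≤sum-p : ∀ {w} → deg w ≡ 2 → sum (r w) + 2 ≤ sum (p w)
  sum-r+2≤sum-p {w} k≡2 = +-cancelʳ-≤ 2 _ _ (begin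
    sum (r w) + 2 + 2                  ≡⟨ +-assoc (sum (r w)) 2 2 ⟩
    sum (r w) + 4                      ≡⟨ cong (sum (r w) +_) (trans (sum-q w) (cong (2 *_) k≡2)) ⟨
    sum (r w) + sum (q w)              ≡⟨ ∑-distrib-+ (r w) (q w) ⟨
    sum (λ v → r w v + q w v)          ≤⟨ sum-mono term ⟩
    sum (λ v → p w v + δ w v * 2)      ≡⟨ ∑-distrib-+ (p w) (λ v → δ w v * 2) ⟩
    sum (p w) + sum (λ v → δ w v * 2)  ≡⟨ cong (sum (p w) +_) (sum-δ* w (λ _ → 2)) ⟩
    sum (p w) + 2                      ∎)
    where
    open ≤-Reasoning
    split : ∀ p q r → p + q + r ≡ 2 → 1 ≤ p → r + q ≤ p
    split (suc p) q r eq (s≤s _) = ≤-trans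
      (≤-trans (m≤n+m (r + q) p) (≤-reflexive (trans (rotate p q r) (suc-injective eq)))) (s≤s z≤n)
      where
      rotate : ∀ p q r → p + (r + q) ≡ p + q + r
      rotate = solve-∀
    term : ∀ v → r w v + q w v ≤ p w v + δ w v * 2
    term v with w ≟ v
    ... | yes refl = ≤-trans (≤-reflexive (trans (cong₂ _+_ (trans (r-self w) k≡2) (q-self w)) refl)) (m≤n+m 2 (p w w))
    ... | no w≢v = ≤-trans (split (p w v) (q w v) (r w v) (trans (p+q+r≡deg w v) k≡2) (1≤p w≢v)) (m≤m+n _ 0)

  -- Summing the surplus 2 over all `w` would give 2n ≤ 0, as the totals of `p` and `r` agree.
  not-all-degree-2 : ¬ (∀ w → deg w ≡ 2)
  not-all-degree-2 all-2 = <⇒≱ (≤-trans (s≤s z≤n) 3≤n) (*-cancelʳ-≤ n 0 2 (+-cancelˡ-≤ (sum₂ r) _ _ (begin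
    sum₂ r + n * 2                ≡⟨ cong (sum₂ r +_) (sum-const n 2) ⟨
    sum₂ r + sum {n} (λ _ → 2)    ≡⟨ ∑-distrib-+ (sum ∘ r) (λ _ → 2) ⟨
    sum (λ w → sum (r w) + 2)     ≤⟨ sum-mono (λ w → sum-r+2≤sum-p (all-2 w)) ⟩
    sum₂ p                        ≡⟨ sum₂-p≡sum₂-r ⟩
    sum₂ r                        ≡⟨ +-identityʳ (sum₂ r) ⟨
    sum₂ r + 0                    ∎)))
    where open ≤-Reasoning

  deg-2-or-3 : ∀ w → deg w ≡ 2 ⊎ deg w ≡ 3
  deg-2-or-3 w with deg w | 2≤deg w | deg≤4 w | deg≢4 w
  ... | 2 | _ | _ | _ = inj₁ refl
  ... | 3 | _ | _ | _ = inj₂ refl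
  ... | 4 | _ | _ | ≢4 = contradiction refl ≢4
  ... | 1 | s≤s () | _ | _
  ... | suc (suc (suc (suc (suc _)))) | _ | s≤s (s≤s (s≤s (s≤s ()))) | _

  deg≡3 : ∀ w → deg w ≡ 3
  deg≡3 w = [ (λ w≡2 → contradiction (all-2 w≡2) not-all-degree-2) , id ]′ (deg-2-or-3 w)
    where
    all-2 : deg w ≡ 2 → ∀ u → deg u ≡ 2
    all-2 w≡2 u = [ id , (λ u≡3 → contradiction w≡2 (no-mixed-degrees u≡3)) ]′ (deg-2-or-3 u)

mainTheorem5 : ∀ (n : ℕ) (G : Graph n) → Connected G → RandomlyDim G 3 → Regular G 3
mainTheorem5 n G conn rd w = trans (degree≡deg w) (deg≡3 w)
  where open Regularity G conn rd
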